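{- Let $I$ be a set, $\mathcal{F}$ a filter on $I$, and $\kappa$ an uncountable cardinal. Then the following statements are equivalent. (a) For every partition of $I$ into $<\kappa$ subsets $J_s$ ($s\in S$), there exist finitely many indices $s_0,\dots,s_{n-1}\in S$ such that $J_{s_0}\cup\dots\cup J_{s_{n-1}}\in\mathcal{F}$. (b) $\mathcal{F}$ is the intersection of finitely many $\kappa$-complete ultrafilters on $I$.
   Context: A filter on a set $I$ is a set $\mathcal{F}$ of subsets of $I$ such that $I\in\mathcal{F}$; if $J\in\mathcal{F}$ and $J\subseteq K\subseteq I$ then $K\in\mathcal{F}$; and if $J,K\in\mathcal{F}$ then $J\cap K\in\mathcal{F}$. A filter may be improper (i.e., equal to the set of all subsets of $I$). A filter is $\kappa$-complete, for $\kappa$ an infinite cardinal, if it is closed under intersections of families of $<\kappa$ members. An ultrafilter is a maximal proper filter. Convention: the intersection of the empty family of ultrafilters is the set of all subsets of $I$ (the improper filter), and "finitely many" allows zero. A partition of a set means an expression of it as the union of an indexed family of pairwise disjoint subsets, which are not required to be nonempty; "into $<\kappa$ subsets" means that the index set $S$ has cardinality $<\kappa$. -}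

module Defs where

open import Data.Nat.Base using (ℕ)
open import Data.Product.Base using (_×_; Σ-syntax)
open import Function.Bundles using (_↣_; module Injection)
open import Induction.WellFounded using (WellFounded)
open import Level using (Level; suc)
open import Relation.Binary.Core using (Rel)
open import Relation.Binary.PropositionalEquality.Core using (_≡_; _≢_)
open import Relation.Binary.Structures using (IsStrictTotalOrder)
open import Relation.Nullary.Negation.Core using (¬_)
open import Relation.Unary
  using (Pred; _∈_; _⊆_; _∩_; _⊥_; ⋃; ⋂; Universal)
open import Relation.Unary.Polymorphic using (U)

private
  variable
    ℓ : Level

-- A cardinal is an initial ordinal: a well-order that does not embed, as a
-- set, in any of its proper initial segments. A map into a segment is given
-- as a bounded map into the whole order, so that proofs of x < a, which need
-- not be unique, do not count towards its size.
record Cardinal (ℓ : Level) : Set (suc ℓ) where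
  field
    Carrier            : Set ℓ
    _<_                : Rel Carrier ℓ
    isStrictTotalOrder : IsStrictTotalOrder _≡_ _<_
    wellFounded        : WellFounded _<_
    initial            : ∀ a →
      ¬ (Σ[ f ∈ Carrier ↣ Carrier ] (∀ x → Injection.to f x < a))

Uncountable : Cardinal ℓ → Set ℓ
Uncountable κ = ¬ (Cardinal.Carrier κ ↣ ℕ)

infix 4 _≺_

-- S has cardinality < κ.
_≺_ : Set ℓ → Cardinal ℓ → Set ℓ
S ≺ κ = (S ↣ Cardinal.Carrier κ) × ¬ (Cardinal.Carrier κ ↣ S)

-- Blocks may be empty.
record IsPartition {I S : Set ℓ} (J : S → Pred I ℓ) : Set ℓ where
  field
    covers   : Universal (⋃ S J)
    disjoint : ∀ {s t} → s ≢ t → J s ⊥ J t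

-- Possibly improper. Upward closure makes F respect equality of extensions.
record IsFilter {I : Set ℓ} (F : Pred (Pred I ℓ) ℓ) : Set (suc ℓ) where
  field
    whole  : U ∈ F
    upward : ∀ {J K} → J ∈ F → J ⊆ K → K ∈ F
    meet   : ∀ {J K} → J ∈ F → K ∈ F → J ∩ K ∈ F

IsProper : {I : Set ℓ} → Pred (Pred I ℓ) ℓ → Set (suc ℓ)
IsProper F = ¬ Universal F

record IsUltrafilter {I : Set ℓ} (F : Pred (Pred I ℓ) ℓ) : Set (suc ℓ) where
  field
    isFilter : IsFilter F
    proper   : IsProper F
    maximal  : ∀ (G : Pred (Pred I ℓ) ℓ) → IsFilter G → IsProper G →
               F ⊆ G → G ⊆ F

IsComplete : {I : Set ℓ} → Cardinal ℓ → Pred (Pred I ℓ) ℓ → Set (suc ℓ)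
IsComplete {ℓ} {I} κ F =
  (S : Set ℓ) → S ≺ κ → (X : S → Pred I ℓ) → (∀ s → X s ∈ F) → ⋂ S X ∈ F

{-# OPTIONS --safe #-}
-- For (a) ⇒ (b), let F ↾ A be the filter generated by F and A, and call A bad if
-- F ↾ A is not a finite intersection of κ-complete ultrafilters. For bad A the
-- filter F ↾ A inherits (a), hence is κ-complete, so it is proper but not an
-- ultrafilter: some B splits A into two F-positive halves. One of them is bad,
-- since F ↾ A is the intersection of F ↾ (A ∩ B) and F ↾ (A ∩ ∁ B). Were I bad,
-- iterating would peel off countably many disjoint F-positive sets, against (a)
-- since ℵ₀ < κ.
module Submission where

open import Defs
open import Axiom.ExcludedMiddle using (ExcludedMiddle)
open import Axiom.DoubleNegationElimination using (em⇒dne)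
open import Data.Empty.Polymorphic using (⊥-elim)
open import Data.Fin.Base using (Fin; zero; toℕ)
open import Data.Fin.Properties using (toℕ-injective)
open import Data.List.Base using (List; []; _∷_; lookup)
open import Data.List.Membership.Propositional using () renaming (_∈_ to _∈ₗ_)
open import Data.List.Relation.Unary.Any using (here; there; index)
open import Data.List.Relation.Unary.Any.Properties using (lookup-index)
open import Data.Nat.Base
  using (ℕ; zero; _+_; _⊔_; _<_; _≤′_; _<′_; ≤′-refl; ≤′-step)
open import Data.Nat.Properties
  using (_≟_; <-cmp; <⇒≢; ≤⇒≤′; <-≤-trans; m≤m⊔n; m≤n⊔m)
open import Data.Product.Base using (_×_; _,_; Σ-syntax; ∃-syntax; proj₁; proj₂)
open import Data.Sum.Base using (_⊎_; inj₁; inj₂; [_,_]′)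
open import Data.Vec.Functional using (_++_)
open import Data.Vec.Functional.Relation.Unary.All.Properties using (++⁺; ++⁻)
open import Function.Base using (_∘_; id; const)
open import Function.Bundles using (_⇔_; _↣_; mk↣; mk⇔)
open import Function.Construct.Composition using (_↣-∘_)
open import Level using (Level; suc; Lift; lift; lower)
open import Relation.Binary.Definitions using (tri<; tri≈; tri>)
open import Relation.Binary.PropositionalEquality
  using (_≡_; _≢_; refl; sym; trans; cong; subst)
open import Relation.Nullary
  using (¬_; Dec; yes; no; contradiction; decidable-stable; map′; toSum)
open import Relation.Unary
  using (Pred; _∈_; _∉_; _⊆_; _≐_; _∩_; _⇒_; _⊥_; ∁; Universal; ⋃; ⋂)
open import Relation.Unary.Polymorphic using (U; ∅)

private
  variable
    ℓ   : Level
    I S : Set ℓ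
    F   : Pred (Pred I ℓ) ℓ

-- Conditions (a) and (b) for a fixed filter.

PartitionProperty : {I : Set ℓ} → Cardinal ℓ → Pred (Pred I ℓ) ℓ → Set (suc ℓ)
PartitionProperty {ℓ} {I} κ F =
  (S : Set ℓ) → S ≺ κ → (J : S → Pred I ℓ) → IsPartition J →
    Σ[ n ∈ ℕ ] Σ[ s ∈ (Fin n → S) ] (⋃ (Fin n) (J ∘ s) ∈ F)

IsFiniteMeetOfCompleteUltrafilters :
  {I : Set ℓ} → Cardinal ℓ → Pred (Pred I ℓ) ℓ → Set (suc ℓ)
IsFiniteMeetOfCompleteUltrafilters {ℓ} {I} κ F =
  Σ[ n ∈ ℕ ] Σ[ V ∈ (Fin n → Pred (Pred I ℓ) ℓ) ]
    ((∀ k → IsUltrafilter (V k) × IsComplete κ (V k)) × (F ≐ ⋂ (Fin n) V))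

finite-bound : ∀ {n} (s : Fin n → ℕ) → ∃[ N ] (∀ k → s k < N)
finite-bound {zero}    s = 0 , λ ()
finite-bound {ℕ.suc n} s with finite-bound (s ∘ Fin.suc)
... | N , s< = ℕ.suc (s zero) ⊔ N , λ where
  zero        → m≤m⊔n (ℕ.suc (s zero)) N
  (Fin.suc k) → <-≤-trans (s< k) (m≤n⊔m (ℕ.suc (s zero)) N)

fibres-isPartition : (f : I → S) → IsPartition (λ s i → f i ≡ s)
fibres-isPartition f = record
  { covers   = λ i → f i , refl
  ; disjoint = λ s≢t (fi≡s , fi≡t) → s≢t (trans (sym fi≡s) fi≡t)
  }

⋂-closed : IsFilter F → ∀ {n} (X : Fin n → Pred I _) →
           (∀ k → X k ∈ F) → ⋂ (Fin n) X ∈ F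
⋂-closed isF {zero}    X X∈F = IsFilter.upward isF (IsFilter.whole isF) λ _ ()
⋂-closed isF {ℕ.suc n} X X∈F =
  upward (meet (X∈F zero) (⋂-closed isF (X ∘ Fin.suc) (X∈F ∘ Fin.suc)))
    λ where
      (x , _) zero        → x
      (_ , y) (Fin.suc k) → y k
  where open IsFilter isF

-- Restriction of a filter to a set.

infix 9 _↾_

-- `A ⇒ K` is the largest J with `J ∩ A ⊆ K`, so its membership in F says that K contains `J ∩ A`
-- for some J in F. Unlike that existential over subsets, it stays at level ℓ.
_↾_ : Pred (Pred I ℓ) ℓ → Pred I ℓ → Pred (Pred I ℓ) ℓ
(F ↾ A) K = (A ⇒ K) ∈ F

↾-isFilter : IsFilter F → ∀ A → IsFilter (F ↾ A)
↾-isFilter isF A = record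
  { whole  = upward whole λ u _ → u
  ; upward = λ j J⊆K → upward j λ a⇒j a → J⊆K (a⇒j a)
  ; meet   = λ j k → upward (meet j k) λ (a⇒j , a⇒k) a → a⇒j a , a⇒k a
  }
  where open IsFilter isF

⊆-↾ : IsFilter F → ∀ A → F ⊆ F ↾ A
⊆-↾ isF A j = IsFilter.upward isF j const

partitionProperty-mono : (κ : Cardinal ℓ) {F G : Pred (Pred I ℓ) ℓ} → F ⊆ G →
  PartitionProperty κ F → PartitionProperty κ G
partitionProperty-mono κ F⊆G pp S S≺κ J part with pp S S≺κ J part
... | n , s , ⋃∈F = n , s , F⊆G ⋃∈F

-- A filter G above F holding some B outside F would also hold `∁ B`, hence the empty set, and be
-- improper.
prime⇒ultrafilter : {F : Pred (Pred I ℓ) ℓ} → IsFilter F → IsProper F →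
  (∀ B → B ∈ F ⊎ ∁ B ∈ F) → IsUltrafilter F
prime⇒ultrafilter isF proper prime = record
  { isFilter = isF
  ; proper   = proper
  ; maximal  = λ G isG properG F⊆G {B} B∈G →
      let open IsFilter isG in
      [ id
      , (λ ∁B∈F → contradiction
          (λ K → upward (meet B∈G (F⊆G ∁B∈F)) λ (b , ¬b) → contradiction b ¬b)
          properG)
      ]′ (prime B)
  }

improper⇒finiteMeet : (κ : Cardinal ℓ) {F : Pred (Pred I ℓ) ℓ} → Universal F →
  IsFiniteMeetOfCompleteUltrafilters κ F
improper⇒finiteMeet κ univ = 0 , (λ ()) , (λ ()) , (λ _ ()) , λ {K} _ → univ K

ultrafilter⇒finiteMeet : (κ : Cardinal ℓ) {F : Pred (Pred I ℓ) ℓ} →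
  IsUltrafilter F → IsComplete κ F → IsFiniteMeetOfCompleteUltrafilters κ F
ultrafilter⇒finiteMeet κ {F} ultra complete =
  1 , const F , const (ultra , complete) , const , λ F∋ → F∋ zero

∩-finiteMeet : (κ : Cardinal ℓ) {F G H : Pred (Pred I ℓ) ℓ} → F ≐ G ∩ H →
  IsFiniteMeetOfCompleteUltrafilters κ G →
  IsFiniteMeetOfCompleteUltrafilters κ H →
  IsFiniteMeetOfCompleteUltrafilters κ F
∩-finiteMeet κ (F⊆ , ⊆F) (m , V , V-cu , G⊆ , ⊆G) (n , W , W-cu , H⊆ , ⊆H) =
  m + n , V ++ W ,
  ++⁺ (λ X → IsUltrafilter X × IsComplete κ X) V-cu W-cu ,
  (λ {K} K∈F → ++⁺ (K ∈_) (G⊆ (proj₁ (F⊆ K∈F))) (H⊆ (proj₂ (F⊆ K∈F)))) ,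
  λ {K} K∈ → let K∈V , K∈W = ++⁻ (K ∈_) V K∈ in ⊆F (⊆G K∈V , ⊆H K∈W)

-- Infinite sequences in uncountable sets.

module _ {ℓ : Level} (em : ExcludedMiddle (suc ℓ)) where

  em₀ : ExcludedMiddle ℓ
  em₀ {P} = map′ lower lift (em {Lift (suc ℓ) P})

  -- Pick recursively an element outside the list of earlier picks. A list exhausting `A` would
  -- inject it into ℕ by positions.
  ¬countable⇒ℕ↣ : {A : Set ℓ} → ¬ (A ↣ ℕ) → ℕ ↣ A
  ¬countable⇒ℕ↣ {A} ¬A↣ℕ = mk↣ {to = λ n → fresh (prefix n)} injective
    where
    listed⇒↣ℕ : (xs : List A) → (∀ x → x ∈ₗ xs) → A ↣ ℕ
    listed⇒↣ℕ xs ∈xs = mk↣ {to = λ x → toℕ (index (∈xs x))} λ {x} {y} eq →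
      trans (lookup-index (∈xs x))
        (trans (cong (lookup xs) (toℕ-injective eq)) (sym (lookup-index (∈xs y))))

    avoiding : (xs : List A) → ∃[ x ] ¬ (x ∈ₗ xs)
    -- Excluded middle applied to the Σ-type yields an actual witness, so `avoiding` acts as a
    -- choice function.
    avoiding xs = em⇒dne em₀ λ none →
      ¬A↣ℕ (listed⇒↣ℕ xs λ x → em⇒dne em₀ λ x∉xs → none (x , x∉xs))

    fresh : List A → A
    fresh = proj₁ ∘ avoiding

    prefix : ℕ → List A
    prefix zero      = []
    prefix (ℕ.suc n) = fresh (prefix n) ∷ prefix n

    fresh∈prefix : ∀ {m n} → m <′ n → fresh (prefix m) ∈ₗ prefix n
    fresh∈prefix ≤′-refl       = here refl
    fresh∈prefix (≤′-step m<n) = there (fresh∈prefix m<n)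

    distinct : ∀ {m n} → m < n → fresh (prefix m) ≢ fresh (prefix n)
    distinct {n = n} m<n eq =
      proj₂ (avoiding (prefix n)) (subst (_∈ₗ prefix n) eq (fresh∈prefix (≤⇒≤′ m<n)))

    injective : ∀ {m n} → fresh (prefix m) ≡ fresh (prefix n) → m ≡ n
    injective {m} {n} eq with <-cmp m n
    ... | tri< m<n _ _ = contradiction eq (distinct m<n)
    ... | tri≈ _ m≡n _ = m≡n
    ... | tri> _ _ n<m = contradiction (sym eq) (distinct n<m)

  ℕ≺uncountable : (κ : Cardinal ℓ) → Uncountable κ → Lift ℓ ℕ ≺ κ
  ℕ≺uncountable κ unc = ¬countable⇒ℕ↣ unc ↣-∘ lower↣ , λ κ↣ℕ → unc (lower↣ ↣-∘ κ↣ℕ)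
    where
    lower↣ : Lift ℓ ℕ ↣ ℕ
    lower↣ = mk↣ {to = lower} (cong lift)

  -- Ultrafilters and partitions.

  module _ {I : Set ℓ} where

    -- `V ↾ B` is a filter extending V and containing B. If proper, maximality puts B in V; if
    -- improper, it contains ∅, which says `∁ B ∈ V`.
    ultrafilter⇒prime : {V : Pred (Pred I ℓ) ℓ} → IsUltrafilter V →
                        ∀ B → B ∉ V → ∁ B ∈ V
    ultrafilter⇒prime {V} ultra B B∉V with em {Universal (V ↾ B)}
    ... | yes univ  = upward (univ ∅) λ b⇒⊥ b → ⊥-elim (b⇒⊥ b)
      where open IsFilter (IsUltrafilter.isFilter ultra)
    ... | no proper = contradiction
      (IsUltrafilter.maximal ultra (V ↾ B) (↾-isFilter isFilter B) proper
        (⊆-↾ isFilter B) (upward whole λ _ → id))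
      B∉V
      where
      open IsUltrafilter ultra using (isFilter)
      open IsFilter isFilter

    -- Otherwise the complement of every block is in V, and completeness puts their intersection in
    -- V. It is empty because the blocks cover I.
    completeUltrafilter-partition : (κ : Cardinal ℓ) {V : Pred (Pred I ℓ) ℓ} →
      IsUltrafilter V → IsComplete κ V →
      {S : Set ℓ} → S ≺ κ → {J : S → Pred I ℓ} → IsPartition J → Σ[ s ∈ S ] J s ∈ V
    completeUltrafilter-partition κ ultra complete {S} S≺κ {J} part =
      em⇒dne em₀ λ none → IsUltrafilter.proper ultra λ K →
        IsFilter.upward (IsUltrafilter.isFilter ultra)
          (complete S S≺κ (∁ ∘ J) λ s → ultrafilter⇒prime ultra (J s) λ Js∈V → none (s , Js∈V))
          λ {i} ∉J → let s , i∈Js = IsPartition.covers part i in contradiction i∈Js (∉J s)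

    -- Each `V k` contains one block; the union of these blocks, repetitions allowed, lies in every
    -- `V k`.
    finiteMeet⇒partitionProperty : (κ : Cardinal ℓ) {F : Pred (Pred I ℓ) ℓ} →
      IsFiniteMeetOfCompleteUltrafilters κ F → PartitionProperty κ F
    finiteMeet⇒partitionProperty κ (n , V , V-cu , _ , ⋂V⊆F) S S≺κ J part =
      n , proj₁ ∘ block , ⋂V⊆F λ k →
        IsFilter.upward (IsUltrafilter.isFilter (proj₁ (V-cu k)))
          (proj₂ (block k)) (k ,_)
      where
      block : ∀ k → Σ[ s ∈ S ] J s ∈ V k
      block k =
        completeUltrafilter-partition κ (proj₁ (V-cu k)) (proj₂ (V-cu k)) S≺κ part

    -- Partition I by an index of some X s that omits the point, with default s₀.
    -- A point in the fibre over s and in X s lies in every X t.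
    partitionProperty⇒complete : (κ : Cardinal ℓ) {F : Pred (Pred I ℓ) ℓ} →
      IsFilter F → PartitionProperty κ F → IsComplete κ F
    partitionProperty⇒complete κ {F} isF pp S S≺κ X X∈F with em₀ {S}
    ... | no ¬s  = IsFilter.upward isF (IsFilter.whole isF) λ _ s → contradiction s ¬s
    ... | yes s₀ = conclude (pp S S≺κ _ (fibres-isPartition f))
      where
      open IsFilter isF

      choose : ∀ {i} → Dec (∃[ s ] i ∉ X s) → S
      choose (yes (s , _)) = s
      choose (no _)        = s₀

      f : I → S
      f i = choose {i} em₀

      chosen⇒all : ∀ {i} (d : Dec (∃[ s ] i ∉ X s)) → i ∈ X (choose d) → i ∈ ⋂ S X
      chosen⇒all (yes (_ , i∉X)) i∈X _ = contradiction i∈X i∉X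
      chosen⇒all (no none)       _   t = em⇒dne em₀ λ i∉Xt → none (t , i∉Xt)

      conclude : Σ[ n ∈ ℕ ] Σ[ s ∈ (Fin n → S) ] (⋃ (Fin n) (λ k i → f i ≡ s k) ∈ F) →
                 ⋂ S X ∈ F
      conclude (n , s , ⋃∈F) =
        -- Only the finitely many `X (s k)` matter on this union, so finite meets suffice.
        upward (meet ⋃∈F (⋂-closed isF (X ∘ s) (X∈F ∘ s)))
          λ {i} ((k , fi≡sk) , i∈X) →
            chosen⇒all em₀ (subst (λ t → i ∈ X t) (sym fi≡sk) (i∈X k))

    -- Index each point by the `C n` containing it. Finitely many fibres have bounded index, so
    -- their union misses some `C N`.
    disjointSequence-null : (κ : Cardinal ℓ) → Uncountable κ →
      {F : Pred (Pred I ℓ) ℓ} → IsFilter F → PartitionProperty κ F →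
      (C : ℕ → Pred I ℓ) → (∀ {m n} → m ≢ n → C m ⊥ C n) → ∃[ n ] ∁ (C n) ∈ F
    disjointSequence-null κ unc {F} isF pp C disjoint =
      conclude (pp (Lift ℓ ℕ) (ℕ≺uncountable κ unc) _ (fibres-isPartition (lift ∘ f)))
      where
      choose : ∀ {i} → Dec (∃[ n ] i ∈ C n) → ℕ
      choose (yes (n , _)) = n
      -- Points outside every `C n` join fibre 0, which is harmless: the bound is applied only to
      -- points of `C N`.
      choose (no _)        = 0

      f : I → ℕ
      f i = choose {i} em₀

      choose-unique : ∀ {i n} (d : Dec (∃[ n ] i ∈ C n)) → i ∈ C n → choose d ≡ n
      choose-unique (yes (m , i∈Cm)) i∈Cn =
        decidable-stable (m ≟ _) λ m≢n → disjoint m≢n (i∈Cm , i∈Cn)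
      choose-unique (no none)        i∈Cn = contradiction (_ , i∈Cn) none

      conclude : Σ[ n ∈ ℕ ] Σ[ s ∈ (Fin n → Lift ℓ ℕ) ]
                   (⋃ (Fin n) (λ k i → lift (f i) ≡ s k) ∈ F) →
                 ∃[ n ] ∁ (C n) ∈ F
      conclude (n , s , ⋃∈F) with finite-bound (lower ∘ s)
      ... | N , s<N = N , IsFilter.upward isF ⋃∈F λ {i} (k , fi≡sk) i∈CN →
        <⇒≢ (s<N k) (trans (sym (cong lower fi≡sk)) (choose-unique em₀ i∈CN))

    -- Descent through bad sets.

    module _ (κ : Cardinal ℓ) (unc : Uncountable κ)
             {F : Pred (Pred I ℓ) ℓ} (isF : IsFilter F) (pp : PartitionProperty κ F) where

      open IsFilter isF

      Bad : Pred I ℓ → Set (suc ℓ)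
      Bad A = ¬ IsFiniteMeetOfCompleteUltrafilters κ (F ↾ A)

      ↾-split : ∀ A B → F ↾ A ≐ F ↾ (A ∩ B) ∩ F ↾ (A ∩ ∁ B)
      ↾-split A B =
        (λ k → upward k (λ a⇒k (a , _) → a⇒k a) , upward k (λ a⇒k (a , _) → a⇒k a)) ,
        λ (k , k′) → upward (meet k k′) λ {i} (ab⇒k , a∁b⇒k) a →
          [ (λ b → ab⇒k (a , b)) , (λ ¬b → a∁b⇒k (a , ¬b)) ]′ (toSum em₀)

      -- Were there no such B, `F ↾ A` would be either improper, the meet of no ultrafilters, or a
      -- complete ultrafilter, the meet of one.
      bad⇒positive-split : ∀ {A} → Bad A → ∃[ B ] B ∉ F ↾ A × ∁ B ∉ F ↾ A
      bad⇒positive-split {A} bad = em⇒dne em λ none →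
        bad (ultrafilter⇒finiteMeet κ
          (prime⇒ultrafilter isF↾A (bad ∘ improper⇒finiteMeet κ) λ B →
            em⇒dne em₀ λ neither →
              none (B , neither ∘ inj₁ , neither ∘ inj₂))
          (partitionProperty⇒complete κ isF↾A
            (partitionProperty-mono κ {F} {F ↾ A} (⊆-↾ isF A) pp)))
        where isF↾A = ↾-isFilter isF A

      -- The last component records that the discarded half `A ∩ ∁ B` is F-positive.
      shrink : ∀ {A} → Bad A → ∃[ B ] Bad (A ∩ B) × B ∉ F ↾ A
      shrink {A} bad with bad⇒positive-split bad
      ... | B , B∉ , ∁B∉ with em {IsFiniteMeetOfCompleteUltrafilters κ (F ↾ (A ∩ B))}
      ...   | no badB  = B , badB , B∉
      -- Now `A ∩ ∁ B` is kept: were it good as well, A would be good.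
      ...   | yes good = ∁ B , bad ∘ ∩-finiteMeet κ (↾-split A B) good , ∁B∉

      bad-descent : ∃[ A ] Bad A → ∃[ A ] Bad A
      bad-descent (A , bad) = let B , badB , _ = shrink bad in A ∩ B , badB

      ¬bad : ∀ {A} → ¬ Bad A
      ¬bad {A} bad = positive (disjointSequence-null κ unc isF pp C disjoint)
        where
        seq : ℕ → ∃[ A ] Bad A
        seq zero      = A , bad
        seq (ℕ.suc n) = bad-descent (seq n)

        set : ℕ → Pred I ℓ
        set n = proj₁ (seq n)

        cut : ℕ → Pred I ℓ
        cut n = proj₁ (shrink (proj₂ (seq n)))

        -- The half discarded on passing from `set n` to its successor.
        C : ℕ → Pred I ℓ
        C n = set n ∩ ∁ (cut n)

        decreasing : ∀ {m n} → m ≤′ n → set n ⊆ set m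
        decreasing ≤′-refl       = id
        decreasing (≤′-step m≤n) = decreasing m≤n ∘ proj₁

        disjoint-< : ∀ {m n} → m < n → C m ⊥ C n
        disjoint-< m<n ((_ , i∉cut) , (i∈set , _)) =
          -- Strictness of `m < n` places `set n` inside the successor of `set m`, which is
          -- `set m ∩ cut m`.
          i∉cut (proj₂ (decreasing (≤⇒≤′ m<n) i∈set))

        disjoint : ∀ {m n} → m ≢ n → C m ⊥ C n
        disjoint {m} {n} m≢n (i∈Cm , i∈Cn) with <-cmp m n
        ... | tri< m<n _ _ = disjoint-< m<n (i∈Cm , i∈Cn)
        ... | tri≈ _ m≡n _ = m≢n m≡n
        ... | tri> _ _ n<m = disjoint-< n<m (i∈Cn , i∈Cm)

        positive : ¬ (∃[ n ] ∁ (C n) ∈ F)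
        -- `∁ (C n) ∈ F` amounts to `cut n ∈ F ↾ set n`, which `shrink` excludes.
        positive (n , ∁C∈F) = proj₂ (proj₂ (shrink (proj₂ (seq n))))
          (upward ∁C∈F λ i∉C i∈set → em⇒dne em₀ λ i∉cut → i∉C (i∈set , i∉cut))

      partitionProperty⇒finiteMeet : IsFiniteMeetOfCompleteUltrafilters κ F
      partitionProperty⇒finiteMeet =
        -- `F ↾ U` has the same members as F, so a decomposition of the former serves for the
        -- latter.
        let n , V , V-cu , F⊆ , ⊆F = em⇒dne em ¬bad
        in n , V , V-cu , F⊆ ∘ ⊆-↾ isF U , λ K∈ → upward (⊆F K∈) λ u⇒k → u⇒k _

lemma4 : {ℓ : Level} → ExcludedMiddle (suc ℓ) →
    (I : Set ℓ) (F : Pred (Pred I ℓ) ℓ) → IsFilter F →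
    (κ : Cardinal ℓ) → Uncountable κ →
    ((S : Set ℓ) → S ≺ κ → (J : S → Pred I ℓ) → IsPartition J →
    Σ[ n ∈ ℕ ] Σ[ s ∈ (Fin n → S) ] (⋃ (Fin n) (J ∘ s) ∈ F))
    ⇔
    (Σ[ n ∈ ℕ ] Σ[ V ∈ (Fin n → Pred (Pred I ℓ) ℓ) ]
    ((∀ k → IsUltrafilter (V k) × IsComplete κ (V k)) × (F ≐ ⋂ (Fin n) V)))
lemma4 em I F isF κ unc = mk⇔
  (partitionProperty⇒finiteMeet em κ unc isF) (finiteMeet⇒partitionProperty em κ)
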